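{- Let $E^{\mathrm{ce}}$ be an equivalence relation on $\omega$ extending $=^{\mathrm{ce}}$. A family $\mathfrak{K}$ of nonempty c.e. sets is $E^{\mathrm{ce}}$-learnable if and only if $\mathfrak{K}$ has no member that is $(\mathfrak{K},E^{\mathrm{ce}})$-absorbing.
   Context: Fix a standard (acceptable) enumeration $(\varphi_e)_{e\in\omega}$ of the partial computable functions and let $W_e=\operatorname{dom}(\varphi_e)$. Write $e=^{\mathrm{ce}}e'$ iff $W_e=W_{e'}$. Equivalence relations on $\omega$ extending $=^{\mathrm{ce}}$ are arbitrary (no definability or effectivity is assumed). An enumeration of a set $A$ is a surjection $\mu:\omega\to A$; $\mu[s]$ denotes the finite string $\mu(0),\dots,\mu(s-1)$. A learner is an arbitrary function $\mathbf{M}:\omega^{<\omega}\to\omega$ (no effectivity is assumed). A family $\mathfrak{K}$ of nonempty c.e. sets is $E^{\mathrm{ce}}$-learnable if there is a learner $\mathbf{M}$ such that for every $e$ with $W_e\in\mathfrak{K}$ and every enumeration $\mu$ of $W_e$ there is $i\in\omega$ with $i\mathrel{E^{\mathrm{ce}}}e$ and $\mathbf{M}(\mu[s])=i$ for all sufficiently large $s$. A set $W_e\in\mathfrak{K}$ is $(\mathfrak{K},E^{\mathrm{ce}})$-absorbing if for every finite set $F\subseteq W_e$ there exists $W_i\in\mathfrak{K}$ such that $i\mathrel{E^{\mathrm{ce}}}e$ fails and $F\subseteq W_i\subsetneq W_e$. -}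

module Defs where

open import Data.Fin.Base using (Fin)
open import Data.List.Base using (List; applyUpTo)
open import Data.List.Relation.Unary.All using (All)
open import Data.Nat.Base using (ℕ; zero; suc; _≤_; _<_)
open import Data.Product.Base using (∃; _×_)
open import Data.Vec.Base using (Vec; []; _∷_; lookup)
open import Data.Vec.Relation.Binary.Pointwise.Inductive using (Pointwise)
open import Function.Bundles using (_⇔_)
open import Level using (Level; 0ℓ; _⊔_) renaming (suc to lsuc)
open import Relation.Binary.Core using (Rel; REL)
open import Relation.Binary.Definitions using (_Respects_)
open import Relation.Binary.PropositionalEquality.Core using (_≡_)
open import Relation.Nullary.Negation.Core using (¬_)
open import Relation.Unary using (Pred; _∈_; _⊆_; _⊂_; _≐_; Satisfiable)

private
  variable
    k ℓ : Level
    m n : ℕ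

-- Programs for the n-ary partial computable (μ-recursive) functions.
-- prec recurses on, and min searches over, the first argument.
data Rec : ℕ → Set where
  zer  : Rec n
  succ : Rec 1
  proj : Fin n → Rec n
  comp : Rec m → Vec (Rec n) m → Rec n
  prec : Rec n → Rec (suc (suc n)) → Rec (suc n)
  min  : Rec (suc n) → Rec n

infix 4 _[_]↝_

-- f [ xs ]↝ y : the computation of f on xs halts with value y.
data _[_]↝_ : Rec n → Vec ℕ n → ℕ → Set where
  zer↝   : {xs : Vec ℕ n} → zer [ xs ]↝ 0
  succ↝  : {x : ℕ} → succ [ x ∷ [] ]↝ suc x
  proj↝  : {xs : Vec ℕ n} {i : Fin n} → proj i [ xs ]↝ lookup xs i
  comp↝  : {f : Rec m} {gs : Vec (Rec n) m} {xs : Vec ℕ n} {zs : Vec ℕ m} {y : ℕ} →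
           Pointwise (λ g z → g [ xs ]↝ z) gs zs → f [ zs ]↝ y →
           comp f gs [ xs ]↝ y
  prec↝₀ : {f : Rec n} {g : Rec (suc (suc n))} {xs : Vec ℕ n} {y : ℕ} →
           f [ xs ]↝ y → prec f g [ zero ∷ xs ]↝ y
  prec↝₁ : {f : Rec n} {g : Rec (suc (suc n))} {xs : Vec ℕ n} {t z y : ℕ} →
           prec f g [ t ∷ xs ]↝ z → g [ t ∷ z ∷ xs ]↝ y →
           prec f g [ suc t ∷ xs ]↝ y
  min↝   : {f : Rec (suc n)} {xs : Vec ℕ n} {y : ℕ} →
           (∀ i → i < y → ∃ λ v → f [ i ∷ xs ]↝ suc v) → f [ y ∷ xs ]↝ 0 →
           min f [ xs ]↝ y

-- φ e x y is read as "φ_e(x) is defined and equal to y".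
Numbering : Set₁
Numbering = ℕ → REL ℕ ℕ 0ℓ

-- Acceptability, as the conjunction of the enumeration and the s-m-n
-- theorems.  By `universal` each φ_e is partial computable; by
-- `parametrization`, applied to a g that ignores its first argument, every
-- unary partial computable function is some φ_e.
record Acceptable (φ : Numbering) : Set where
  field
    universal       : ∃ λ (u : Rec 2) → ∀ e x y → φ e x y ⇔ u [ e ∷ x ∷ [] ]↝ y
    parametrization : ∀ (g : Rec 2) → ∃ λ (s : Rec 1) → ∀ e →
                      ∃ λ e′ → s [ e ∷ [] ]↝ e′ ×
                               (∀ x y → φ e′ x y ⇔ g [ e ∷ x ∷ [] ]↝ y)

record Enumerates (μ : ℕ → ℕ) (A : Pred ℕ 0ℓ) : Set where
  field
    into : ∀ s → μ s ∈ A
    onto : ∀ {x} → x ∈ A → ∃ λ s → μ s ≡ x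

Learner : Set
Learner = List ℕ → ℕ

module _ (φ : Numbering) where

  W : ℕ → Pred ℕ 0ℓ
  W e x = ∃ λ y → φ e x y

  SameCE : Rel ℕ 0ℓ
  SameCE i j = W i ≐ W j

  -- A family of sets is a predicate on subsets of ℕ.  Subsets are themselves
  -- predicates, so set equality is ≐ and the family has to respect it.
  record IsCEFamily (K : Pred (Pred ℕ 0ℓ) k) : Set (lsuc 0ℓ ⊔ k) where
    field
      respects : K Respects _≐_
      nonempty : ∀ {A} → A ∈ K → Satisfiable A
      ce       : ∀ {A} → A ∈ K → ∃ λ e → A ≐ W e

  Learnable : Pred (Pred ℕ 0ℓ) k → Rel ℕ ℓ → Set (k ⊔ ℓ)
  Learnable K E =
    ∃ λ (M : Learner) → ∀ e → W e ∈ K → ∀ μ → Enumerates μ (W e) →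
    ∃ λ i → E i e × (∃ λ s₀ → ∀ s → s₀ ≤ s → M (applyUpTo μ s) ≡ i)

  -- The finite sets F are given by lists of their elements.
  Absorbing : Pred (Pred ℕ 0ℓ) k → Rel ℕ ℓ → ℕ → Set (k ⊔ ℓ)
  Absorbing K E e =
    W e ∈ K ×
    (∀ (F : List ℕ) → All (_∈ W e) F →
     ∃ λ i → W i ∈ K × ¬ E i e × All (_∈ W i) F × W i ⊂ W e)

{-# OPTIONS --safe #-}

-- If a learner succeeds on W_e, some finite σ ⊆ W_e is locking: no extension
-- of σ inside W_e changes the conjecture, since otherwise a limit of
-- extensions would be an enumeration of W_e with infinitely many mind changes.
-- Any W_i ∈ K with σ ⊆ W_i ⊆ W_e can then be enumerated starting with σ, so
-- M(σ) is a correct index for both e and i; hence e is not absorbing.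
-- Conversely, if e is not absorbing, then it has a finite telltale F ⊆ W_e such
-- that every W_i ∈ K with F ⊆ W_i ⊂ W_e satisfies i E e.  The learner guesses
-- the least e having a telltale F with F ⊆ content ⊆ W_e.

module Submission where

open import Defs
open import Axiom.ExcludedMiddle using (ExcludedMiddle)
open import Data.List.Base using (List; []; _∷_; [_]; _++_; length; applyUpTo)
open import Data.List.Membership.Propositional using () renaming (_∈_ to _∈ᴸ_)
open import Data.List.Membership.Propositional.Properties
  using (∈-applyUpTo⁺; ∈-applyUpTo⁻; ∈-++⁺ʳ)
open import Data.List.Properties
  using (++-assoc; ++-identityʳ; length-++; length-applyUpTo; ∷-injective)
open import Data.List.Relation.Unary.All as All using (All; []; _∷_)
open import Data.List.Relation.Unary.All.Properties
  using (++⁺; applyUpTo⁺₂; applyUpTo⁻)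
open import Data.List.Relation.Unary.Any using (here)
open import Data.Nat.Base
  using (ℕ; zero; suc; _+_; _≤_; _<_; z≤n; s≤s; z<s; s<s; s≤s⁻¹; s<s⁻¹;
         _≤′_; ≤′-refl; ≤′-step)
  renaming (_⊔_ to _⊔ℕ_)
open import Data.Nat.Properties
  using (<-cmp; ≤-refl; ≤-trans; ≤-total; ≤⇒≤′; m≤m⊔n; m≤n⊔m;
         m≤n+m; +-comm; m<1+n⇒m<n∨m≡n; module ≤-Reasoning)
open import Data.Product.Base using (∃; _×_; _,_; proj₁; proj₂; map₂)
open import Data.Sum.Base using (inj₁; inj₂)
open import Function.Base using (_∘_; _$_)
open import Function.Bundles using (_⇔_; mk⇔)
open import Level using (Level; 0ℓ; Lift; lift; lower; _⊔_)
open import Relation.Binary.Core using (Rel; _⇒_)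
open import Relation.Binary.Definitions using (tri<; tri≈; tri>)
open import Relation.Binary.PropositionalEquality
  using (_≡_; _≢_; refl; sym; trans; cong; cong₂; subst; module ≡-Reasoning)
open import Relation.Binary.Structures using (IsEquivalence)
open import Relation.Nullary.Decidable using (yes; no; map′; decidable-stable)
open import Relation.Nullary.Negation using (¬_; contradiction)
open import Relation.Unary
  using (Pred; Decidable; Satisfiable; _∈_; _⊆_; _⊂_)

private
  variable
    a p q : Level
    A : Set a

em-lower : ∀ a b → ExcludedMiddle (a ⊔ b) → ExcludedMiddle a
em-lower a b em {P} = map′ lower lift (em {Lift b P})

-- Properties of stages that hold from some stage on.

Eventually : Pred ℕ p → Set p
Eventually P = ∃ λ s₀ → ∀ s → s₀ ≤ s → P s

eventually-map : {P : Pred ℕ p} {Q : Pred ℕ q} → P ⊆ Q → Eventually P → Eventually Q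
eventually-map P⊆Q (s₀ , Ps) = s₀ , λ s s₀≤s → P⊆Q (Ps s s₀≤s)

eventually-× : {P : Pred ℕ p} {Q : Pred ℕ q} →
               Eventually P → Eventually Q → Eventually (λ s → P s × Q s)
eventually-× (s₁ , Ps) (s₂ , Qs) = s₁ ⊔ℕ s₂ , λ s s₀≤s →
  Ps s (≤-trans (m≤m⊔n s₁ s₂) s₀≤s) , Qs s (≤-trans (m≤n⊔m s₁ s₂) s₀≤s)

eventually-∀< : {P : ℕ → Pred ℕ p} (n : ℕ) → (∀ {j} → j < n → Eventually (P j)) →
                Eventually (λ s → ∀ {j} → j < n → P j s)
eventually-∀< zero    _  = 0 , λ _ _ ()
eventually-∀< {P = P} (suc n) ev =
  eventually-map combine
    (eventually-× (ev ≤-refl) (eventually-∀< n (λ j<n → ev (≤-trans j<n (m≤n+m n 1)))))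
  where
  combine : ∀ {s} → P n s × (∀ {j} → j < n → P j s) → ∀ {j} → j < suc n → P j s
  combine (Pn , Ps) j<1+n with m<1+n⇒m<n∨m≡n j<1+n
  ... | inj₁ j<n  = Ps j<n
  ... | inj₂ refl = Pn

eventually-All : {P : A → Pred ℕ p} {xs : List A} → All (λ x → Eventually (P x)) xs →
                 Eventually (λ s → All (λ x → P x s) xs)
eventually-All []         = 0 , λ _ _ → []
eventually-All (ev ∷ evs) =
  eventually-map (λ (Px , Pxs) → Px ∷ Pxs) (eventually-× ev (eventually-All evs))

-- Least witnesses and bounded search.

IsLeast : Pred ℕ p → Pred ℕ p
IsLeast P n = P n × (∀ {j} → j < n → ¬ P j)

isLeast-unique : {P : Pred ℕ p} {m n : ℕ} → IsLeast P m → IsLeast P n → m ≡ n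
isLeast-unique {m = m} {n} (Pm , <m) (Pn , <n) with <-cmp m n
... | tri< m<n _ _ = contradiction Pm (<n m<n)
... | tri≈ _ m≡n _ = m≡n
... | tri> _ _ n<m = contradiction Pn (<m n<m)

-- Returns n when there is no witness below n.
leastBelow : {P : Pred ℕ p} → Decidable P → ℕ → ℕ
leastBelow P? zero    = 0
leastBelow P? (suc n) with P? 0
... | yes _ = 0
... | no  _ = suc (leastBelow (P? ∘ suc) n)

leastBelow-isLeast : {P : Pred ℕ p} (P? : Decidable P) {m n : ℕ} → P m → m < n →
                     IsLeast P (leastBelow P? n)
leastBelow-isLeast P? {m} {suc n} Pm m<n with P? 0
... | yes P0 = P0 , λ ()
leastBelow-isLeast P? {zero}  {suc n} Pm m<n | no ¬P0 = contradiction Pm ¬P0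
leastBelow-isLeast {P = P} P? {suc m} {suc n} Pm m<n | no ¬P0 = proj₁ rec , below
  where
  rec : IsLeast (P ∘ suc) (leastBelow (P? ∘ suc) n)
  rec = leastBelow-isLeast (P? ∘ suc) Pm (s<s⁻¹ m<n)

  below : ∀ {j} → j < suc (leastBelow (P? ∘ suc) n) → ¬ P j
  below {zero}  _   = ¬P0
  below {suc j} j<k = proj₂ rec (s<s⁻¹ j<k)

-- Initial segments of sequences, and limits of chains of strings.

prepend : List A → (ℕ → A) → ℕ → A
prepend []       f s       = f s
prepend (x ∷ xs) f zero    = x
prepend (x ∷ xs) f (suc s) = prepend xs f s

applyUpTo-prepend : ∀ xs (f : ℕ → A) s →
                    applyUpTo (prepend xs f) (length xs + s) ≡ xs ++ applyUpTo f s
applyUpTo-prepend []       f s = refl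
applyUpTo-prepend (x ∷ xs) f s = cong (x ∷_) (applyUpTo-prepend xs f s)

prepend-+ : ∀ xs (f : ℕ → A) s → prepend xs f (length xs + s) ≡ f s
prepend-+ []       f s = refl
prepend-+ (x ∷ xs) f s = prepend-+ xs f s

prepend-All : {P : Pred A p} {xs : List A} {f : ℕ → A} →
              All P xs → (∀ s → P (f s)) → ∀ s → P (prepend xs f s)
prepend-All []         Pf s       = Pf s
prepend-All (px ∷ pxs) Pf zero    = px
prepend-All (px ∷ pxs) Pf (suc s) = prepend-All pxs Pf s

nth : A → List A → ℕ → A
nth d []       _       = d
nth d (x ∷ xs) zero    = x
nth d (x ∷ xs) (suc s) = nth d xs s

nth-++ˡ : ∀ (d : A) xs ys {s} → s < length xs → nth d (xs ++ ys) s ≡ nth d xs s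
nth-++ˡ d (x ∷ xs) ys {zero}  _   = refl
nth-++ˡ d (x ∷ xs) ys {suc s} s<n = nth-++ˡ d xs ys (s<s⁻¹ s<n)

applyUpTo-nth : ∀ (d : A) xs {f : ℕ → A} → (∀ {s} → s < length xs → f s ≡ nth d xs s) →
                applyUpTo f (length xs) ≡ xs
applyUpTo-nth d []       eq = refl
applyUpTo-nth d (x ∷ xs) eq = cong₂ _∷_ (eq z<s) (applyUpTo-nth d xs (eq ∘ s<s))

applyUpTo-++ˡ : ∀ xs {ys} {f : ℕ → A} → applyUpTo f (length (xs ++ ys)) ≡ xs ++ ys →
                applyUpTo f (length xs) ≡ xs
applyUpTo-++ˡ []       eq = refl
applyUpTo-++ˡ (x ∷ xs) eq with fx , fxs ← ∷-injective eq =
  cong₂ _∷_ fx (applyUpTo-++ˡ xs fxs)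

chain-limit : A → (σ : ℕ → List A) → (∀ n → ∃ λ τ → σ (suc n) ≡ σ n ++ τ) →
              (∀ n → n ≤ length (σ n)) →
              ∃ λ (f : ℕ → A) → ∀ n → applyUpTo f (length (σ n)) ≡ σ n
chain-limit d σ extends long = f , λ n → applyUpTo-nth d (σ n) (agrees n)
  where
  f : ℕ → _
  -- By `long`, `σ (suc s)` has at least `suc s` entries, so position `s` exists and the default `d`
  -- is never read here.
  f s = nth d (σ (suc s)) s

  extends-≤′ : ∀ {m n} → m ≤′ n → ∃ λ τ → σ n ≡ σ m ++ τ
  extends-≤′ {m} ≤′-refl = [] , sym (++-identityʳ (σ m))
  extends-≤′ {m} (≤′-step {n} m≤n)
    with τ , eq ← extends-≤′ m≤n | τ′ , eq′ ← extends n =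
    τ ++ τ′ , trans eq′ (trans (cong (_++ τ′) eq) (++-assoc (σ m) τ τ′))

  nth-stable : ∀ {m n s} → m ≤ n → s < length (σ m) → nth d (σ n) s ≡ nth d (σ m) s
  nth-stable {m} {n} {s} m≤n s<len with τ , eq ← extends-≤′ (≤⇒≤′ m≤n) =
    trans (cong (λ xs → nth d xs s) eq) (nth-++ˡ d (σ m) τ s<len)

  agrees : ∀ n {s} → s < length (σ n) → f s ≡ nth d (σ n) s
  agrees n {s} s<len with ≤-total n (suc s)
  ... | inj₁ n≤1+s = nth-stable n≤1+s s<len
  ... | inj₂ 1+s≤n = sym (nth-stable 1+s≤n (long (suc s)))

-- Enumerations of a set.

enumerates-prepend : {B : Pred ℕ 0ℓ} {xs : List ℕ} {ν : ℕ → ℕ} →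
                     All B xs → Enumerates ν B → Enumerates (prepend xs ν) B
enumerates-prepend {xs = xs} {ν} Bxs en = record
  { into = prepend-All Bxs into
  ; onto = λ x∈B → let s , eq = onto x∈B in
      length xs + s , trans (prepend-+ xs ν s) eq
  }
  where open Enumerates en

-- Each member enumerates itself and every non-member is replaced by the fixed member `x₀`.
-- Enumerations are arbitrary surjections, so membership may be decided classically.
∃-enumeration : ExcludedMiddle 0ℓ → {B : Pred ℕ 0ℓ} → Satisfiable B →
                ∃ λ ν → Enumerates ν B
∃-enumeration em {B} (x₀ , x₀∈B) = ν , record { into = into ; onto = onto }
  where
  ν : ℕ → ℕ
  ν n with em {B n}
  ... | yes _ = n
  ... | no  _ = x₀

  into : ∀ n → B (ν n)
  into n with em {B n}
  ... | yes n∈B = n∈B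
  ... | no  _   = x₀∈B

  onto : ∀ {x} → B x → ∃ λ n → ν n ≡ x
  onto {x} x∈B = x , eq
    where
    eq : ν x ≡ x
    eq with em {B x}
    ... | yes _   = refl
    ... | no  x∉B = contradiction x∈B x∉B

-- Locking sequences in the sense of Blum and Blum.

Locking : Learner → Pred ℕ 0ℓ → Pred (List ℕ) 0ℓ
Locking M B σ = All B σ × (∀ τ → All B τ → M (σ ++ τ) ≡ M σ)

Converges : Learner → (ℕ → ℕ) → Set
Converges M μ = ∃ λ i → Eventually (λ s → M (applyUpTo μ s) ≡ i)

module _ (em : ExcludedMiddle 0ℓ) {M : Learner} {B : Pred ℕ 0ℓ} where

  mind-change : ¬ ∃ (Locking M B) → ∀ σ → All B σ →
                ∃ λ τ → All B τ × M (σ ++ τ) ≢ M σ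
  mind-change ¬locking σ Bσ = decidable-stable em λ ¬change →
    ¬locking $ σ , Bσ , λ τ Bτ →
    decidable-stable em λ M≢ → ¬change (τ , Bτ , M≢)

  module Divergence (change : ∀ σ → All B σ → ∃ λ τ → All B τ × M (σ ++ τ) ≢ M σ)
                    {ν : ℕ → ℕ} (en : Enumerates ν B) where
    module ν = Enumerates en

    chain : ℕ → ∃ (All B)
    chain zero    = [] , []
    chain (suc n) with σ , Bσ ← chain n with τ , Bτ , _ ← change σ Bσ =
      -- `τ` forces a mind change; the entry `ν n` makes the limit exhaust `B`, and makes each
      -- string strictly longer than the last even before `τ` is counted.
      (σ ++ τ) ++ [ ν n ] , ++⁺ (++⁺ Bσ Bτ) (ν.into n ∷ [])

    σ : ℕ → List ℕ
    σ = proj₁ ∘ chain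

    τ : ℕ → List ℕ
    τ n = proj₁ (change (σ n) (proj₂ (chain n)))

    long : ∀ n → n ≤ length (σ n)
    long zero    = z≤n
    long (suc n) = begin
      suc n                             ≤⟨ s≤s (long n) ⟩
      suc (length (σ n))                ≤⟨ s≤s (m≤n+m (length (σ n)) (length (τ n))) ⟩
      suc (length (τ n) + length (σ n)) ≡⟨ cong suc (+-comm (length (τ n)) _) ⟩
      suc (length (σ n) + length (τ n)) ≡⟨ cong suc (length-++ (σ n)) ⟨
      suc (length (σ n ++ τ n))         ≡⟨ +-comm 1 _ ⟩
      length (σ n ++ τ n) + 1           ≡⟨ length-++ (σ n ++ τ n) ⟨
      length (σ (suc n))                ∎
      where open ≤-Reasoning

    limit : ∃ λ (μ : ℕ → ℕ) → ∀ n → applyUpTo μ (length (σ n)) ≡ σ n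
    limit = chain-limit 0 σ (λ n → τ n ++ [ ν n ] , ++-assoc (σ n) (τ n) _) long

    μ : ℕ → ℕ
    μ = proj₁ limit

    σ-initial : ∀ n → applyUpTo μ (length (σ n)) ≡ σ n
    σ-initial = proj₂ limit

    enumerates : Enumerates μ B
    enumerates = record
      -- Position `s` already lies within `σ (suc s)`, whose entries are all in `B`.
      { into = λ s → applyUpTo⁻ μ _
          (subst (All B) (sym (σ-initial (suc s))) (proj₂ (chain (suc s)))) (long (suc s))
      ; onto = λ x∈B → onto (ν.onto x∈B)
      }
      where
      onto : ∀ {x} → (∃ λ n → ν n ≡ x) → ∃ λ s → μ s ≡ x
      onto (n , refl) with s , _ , eq ← ∈-applyUpTo⁻ μ
        (subst (ν n ∈ᴸ_) (sym (σ-initial (suc n))) (∈-++⁺ʳ (σ n ++ τ n) (here refl)))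
        = s , sym eq

    -- The alleged convergence stage `n` is reused as a chain index: `σ n` and `σ n ++ τ n` are
    -- initial segments of `μ` of length at least `n`, yet `M` differs on them.
    diverges : ¬ Converges M μ
    diverges (i , n , M≡i) = proj₂ (proj₂ (change (σ n) (proj₂ (chain n))))
      (trans (value (applyUpTo-++ˡ (σ n ++ τ n) (σ-initial (suc n))) n≤στ)
             (sym (value (σ-initial n) (long n))))
      where
      value : ∀ {ρ} → applyUpTo μ (length ρ) ≡ ρ → n ≤ length ρ → M ρ ≡ i
      value eq n≤ρ = trans (cong M (sym eq)) (M≡i _ n≤ρ)

      n≤στ : n ≤ length (σ n ++ τ n)
      n≤στ = s≤s⁻¹ (subst (suc n ≤_)
        (trans (length-++ (σ n ++ τ n)) (+-comm _ 1)) (long (suc n)))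

  ∃-locking : Satisfiable B → (∀ μ → Enumerates μ B → Converges M μ) → ∃ (Locking M B)
  ∃-locking B≠∅ converges = decidable-stable em λ ¬locking →
    let open Divergence (mind-change ¬locking) (proj₂ (∃-enumeration em B≠∅)) in
    diverges (converges μ enumerates)

-- Learnable families have no absorbing members.

module _ {k ℓ : Level} (em : ExcludedMiddle (k ⊔ ℓ)) (φ : Numbering)
         (E : Rel ℕ ℓ) (E-equiv : IsEquivalence E) (=ᶜᵉ⇒E : SameCE φ ⇒ E)
         (K : Pred (Pred ℕ 0ℓ) k) (K-ce : IsCEFamily φ K) where

  private
    module E = IsEquivalence E-equiv
    open IsCEFamily K-ce using (nonempty)

    em₀ : ExcludedMiddle 0ℓ
    em₀ = em-lower 0ℓ (k ⊔ ℓ) em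

    emˡ : ExcludedMiddle ℓ
    emˡ = em-lower ℓ k em

  -- An enumeration of `W φ j` that starts with `σ` stays inside `W φ e`, so the lock keeps the
  -- conjecture at `M σ`, while learning makes its limit correct for `j`.
  locking-correct : ((M , _) : Learnable φ K E) → ∀ {e j σ} → Locking M (W φ e) σ →
    W φ j ∈ K → All (W φ j) σ → W φ j ⊆ W φ e → E (M σ) j
  locking-correct (M , learns) {j = j} {σ} (_ , locks) Wj∈K σ⊆Wj Wj⊆We =
    let ν , en = ∃-enumeration em₀ (nonempty Wj∈K)
        i , iEj , s₀ , M≡i = learns j Wj∈K (prepend σ ν) (enumerates-prepend σ⊆Wj en)
        ν[s₀]⊆We = applyUpTo⁺₂ ν s₀ (Wj⊆We ∘ Enumerates.into en)
        open ≡-Reasoning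
        Mσ≡i : M σ ≡ i
        Mσ≡i = begin
          M σ                                          ≡⟨ locks _ ν[s₀]⊆We ⟨
          M (σ ++ applyUpTo ν s₀)                      ≡⟨ cong M (applyUpTo-prepend σ ν s₀) ⟨
          M (applyUpTo (prepend σ ν) (length σ + s₀))  ≡⟨ M≡i _ (m≤n+m s₀ (length σ)) ⟩
          i                                            ∎
    in subst (λ n → E n j) (sym Mσ≡i) iEj

  learnable⇒¬absorbing : Learnable φ K E → ¬ ∃ (Absorbing φ K E)
  learnable⇒¬absorbing L@(M , learns) (e , We∈K , absorbs) =
    let σ , locking@(σ⊆We , _) = ∃-locking em₀ {M} (nonempty We∈K)
          (λ μ en → map₂ proj₂ (learns e We∈K μ en))
        -- The locking string itself serves as the finite set in the absorbing property.
        i , Wi∈K , ¬iEe , σ⊆Wi , Wi⊆We , _ = absorbs σ σ⊆We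
    in ¬iEe (E.trans (E.sym (locking-correct L locking Wi∈K σ⊆Wi Wi⊆We))
                     (locking-correct L locking We∈K σ⊆We (λ x∈ → x∈)))

  -- Telltale sets in Angluin's sense, relaxed up to `E`.

  Telltale : ℕ → List ℕ → Set (k ⊔ ℓ)
  Telltale e F = W φ e ∈ K × All (_∈ W φ e) F ×
    (∀ i → W φ i ∈ K → All (_∈ W φ i) F → W φ i ⊂ W φ e → E i e)

  ∃-telltale : ¬ ∃ (Absorbing φ K E) → ∀ {e} → W φ e ∈ K → ∃ (Telltale e)
  ∃-telltale ¬absorbing {e} We∈K = decidable-stable em λ ¬telltale →
    ¬absorbing $ e , We∈K , λ F F⊆We →
    decidable-stable em λ ¬counterexample →
    ¬telltale $ F , We∈K , F⊆We , λ i Wi∈K F⊆Wi Wi⊂We →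
    decidable-stable emˡ λ ¬iEe →
    ¬counterexample (i , Wi∈K , ¬iEe , F⊆Wi , Wi⊂We)

  Consistent : List ℕ → Pred ℕ (k ⊔ ℓ)
  Consistent xs e = ∃ λ F → Telltale e F × All (_∈ᴸ xs) F × All (W φ e) xs

  -- The limit notion that `Consistent` approximates: the whole set `B` takes the place of the
  -- finite sample.
  Fits : Pred ℕ 0ℓ → Pred ℕ (k ⊔ ℓ)
  Fits B e = ∃ λ F → Telltale e F × All B F × B ⊆ W φ e

  module _ {B : Pred ℕ 0ℓ} {μ : ℕ → ℕ} (en : Enumerates μ B) where
    open Enumerates en

    private
      Seen : ℕ → ℕ → Set
      Seen x s = x ∈ᴸ applyUpTo μ s

    eventually-∈ : ∀ {x} → B x → Eventually (Seen x)
    eventually-∈ x∈B with s , refl ← onto x∈B =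
      suc s , λ _ s<s′ → ∈-applyUpTo⁺ μ s<s′

    fits⇒eventually-consistent : ∀ {e} → Fits B e →
      Eventually (λ s → Consistent (applyUpTo μ s) e)
    fits⇒eventually-consistent (F , telltale , F⊆B , B⊆We) =
      eventually-map (λ F⊆μ[s] → F , telltale , F⊆μ[s] , applyUpTo⁺₂ μ _ (B⊆We ∘ into))
        (eventually-All {P = Seen} (All.map eventually-∈ F⊆B))

    -- Either some element of `B` outside `W φ e` shows up and refutes `e` from then on, or `B` is
    -- contained in `W φ e`. In the latter case consistency at any stage would put a telltale inside
    -- `B`, so `e` is inconsistent from stage 0.
    ¬fits⇒eventually-inconsistent : ∀ {e} → ¬ Fits B e →
      Eventually (λ s → ¬ Consistent (applyUpTo μ s) e)
    ¬fits⇒eventually-inconsistent {e} ¬fits with em₀ {∃ λ x → B x × ¬ W φ e x}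
    ... | yes (x , x∈B , x∉We) = eventually-map
      (λ x∈μ[s] (_ , _ , _ , μ[s]⊆We) → x∉We (All.lookup μ[s]⊆We x∈μ[s]))
      (eventually-∈ x∈B)
    ... | no ¬x = 0 , λ s _ (F , telltale , F⊆μ[s] , _) → ¬fits
      ( F , telltale , All.map (All.lookup (applyUpTo⁺₂ μ s into)) F⊆μ[s]
      , λ {x} x∈B → decidable-stable em₀ λ x∉We → ¬x (x , x∈B , x∉We))

    -- Only finitely many smaller indices have to be refuted, so one stage serves for all.
    isLeast-fits⇒eventually-isLeast-consistent : ∀ {e} → IsLeast (Fits B) e →
      Eventually (λ s → IsLeast (Consistent (applyUpTo μ s)) e)
    isLeast-fits⇒eventually-isLeast-consistent {e} (fits , ¬fits) =
      eventually-× (fits⇒eventually-consistent fits)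
        (eventually-∀< e (¬fits⇒eventually-inconsistent ∘ ¬fits))

  learner : Learner
  -- The sample length as search bound makes the learner total, and it eventually exceeds any fixed
  -- index.
  learner xs = leastBelow {P = Consistent xs} (λ _ → em) (length xs)

  -- If `W φ a` is properly inside `W φ i`, the telltale of `i` yields the equivalence; if the two
  -- sets coincide, `=ᶜᵉ⇒E` does. Assuming inequivalence thus makes the inclusion strict.
  fits⇒E : ∀ {a i} → W φ a ∈ K → Fits (W φ a) i → E i a
  fits⇒E Wa∈K (F , (_ , _ , telltale) , F⊆Wa , Wa⊆Wi) = decidable-stable emˡ λ ¬iEa →
    ¬iEa (E.sym (telltale _ Wa∈K F⊆Wa
      (Wa⊆Wi , λ Wi⊆Wa → ¬iEa (=ᶜᵉ⇒E (Wi⊆Wa , Wa⊆Wi)))))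

  ¬absorbing⇒learnable : ¬ ∃ (Absorbing φ K E) → Learnable φ K E
  ¬absorbing⇒learnable ¬absorbing = learner , λ a Wa∈K μ en →
    let F , telltale@(_ , F⊆Wa , _) = ∃-telltale ¬absorbing Wa∈K
        -- The index `a` itself fits, so a search strictly below `suc a` succeeds.
        i       = leastBelow {P = Fits (W φ a)} (λ _ → em) (suc a)
        i-least : IsLeast (Fits (W φ a)) i
        i-least = leastBelow-isLeast (λ _ → em) (F , telltale , F⊆Wa , λ {_} x∈ → x∈) ≤-refl
    in
    i , fits⇒E Wa∈K (proj₁ i-least) ,
    eventually-map
      (λ {s} (least , i<len) → isLeast-unique
        (leastBelow-isLeast (λ _ → em) (proj₁ least) i<len) least)
      (eventually-× (isLeast-fits⇒eventually-isLeast-consistent en i-least)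
        -- From stage `suc i` on, the sample is long enough for the learner's bounded search to
        -- reach `i`.
        (suc i , λ s i<s → subst (i <_) (sym (length-applyUpTo μ s)) i<s))

proposition3p5 : {k ℓ : Level} → ExcludedMiddle (k ⊔ ℓ) →
    (φ : Numbering) → Acceptable φ →
    (E : Rel ℕ ℓ) → IsEquivalence E → SameCE φ ⇒ E →
    (K : Pred (Pred ℕ 0ℓ) k) → IsCEFamily φ K →
    Learnable φ K E ⇔ (¬ (∃ λ e → Absorbing φ K E e))
proposition3p5 em φ _ E E-equiv =ᶜᵉ⇒E K K-ce = mk⇔
  (learnable⇒¬absorbing em φ E E-equiv =ᶜᵉ⇒E K K-ce)
  (¬absorbing⇒learnable em φ E E-equiv =ᶜᵉ⇒E K K-ce)
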